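{- Let $\mathrm{a}_{n,k}^{\mathrm{des}}(123,132)$ denote the number of permutations of $\{1,\dots,n\}$ that avoid both $123$ and $132$ and have exactly $k$ descents. Then for all integers $n\ge1$ and $k\ge0$, $$\mathrm{a}_{n,k}^{\mathrm{des}}(123,132)=\binom{n}{2(n-k-1)}.$$
   Context: $\mathcal{S}_n$ is the set of permutations $\pi=\pi_1\cdots\pi_n$ of $\{1,\dots,n\}$. For $\rho\in\mathcal{S}_m$, $\pi\in\mathcal{S}_n$ contains $\rho$ if there are indices $1\le i_1<\cdots<i_m\le n$ such that $\pi_{i_a}<\pi_{i_b}$ if and only if $\rho_a<\rho_b$; otherwise $\pi$ avoids $\rho$. The number of descents is $\mathrm{des}(\pi)=|\{i:\pi_i>\pi_{i+1}\}|$, where $1\le i\le n-1$. Binomial coefficients $\binom{m}{j}$ (with $m\ge0$) are $0$ when the integer $j$ satisfies $j<0$ or $j>m$. -}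

module Defs where

open import Data.Fin.Base using (Fin; suc; inject₁; _<_)
open import Data.Fin.Patterns using (1F; 2F)
open import Data.Fin.Permutation as Perm using (Permutation′; _⟨$⟩ʳ_; _≈_)
open import Data.Fin.Properties using (_<?_)
open import Data.Integer.Base using (ℤ; +_; -[1+_])
open import Data.List.Base using (length; filter; allFin)
open import Data.Nat.Base using (ℕ; zero; suc)
open import Data.Nat.Combinatorics using (_C_)
open import Data.Product.Base using (Σ; Σ-syntax; _×_; proj₁)
open import Function.Bundles using (Inverse; _⇔_)
open import Level using (Level; 0ℓ; _⊔_)
open import Relation.Binary.Bundles using (Setoid)
open import Relation.Binary.PropositionalEquality using (_≡_; refl; sym; trans; setoid)
open import Relation.Nullary using (¬_)

Contains : ∀ {m n} → Permutation′ m → Permutation′ n → Set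
Contains {m} {n} ρ π =
  Σ[ i ∈ (Fin m → Fin n) ]
    (∀ a b → a < b → i a < i b) ×
    (∀ a b → ((π ⟨$⟩ʳ i a) < (π ⟨$⟩ʳ i b)) ⇔ ((ρ ⟨$⟩ʳ a) < (ρ ⟨$⟩ʳ b)))

Avoids : ∀ {m n} → Permutation′ m → Permutation′ n → Set
Avoids ρ π = ¬ Contains ρ π

des : ∀ {n} → Permutation′ n → ℕ
des {zero}  π = 0
des {suc m} π =
  length (filter (λ i → (π ⟨$⟩ʳ suc i) <? (π ⟨$⟩ʳ inject₁ i)) (allFin m))

-- One-line notation, shifted to start at 0: p123 is 012 and p132 is 021.

p123 : Permutation′ 3
p123 = Perm.id

p132 : Permutation′ 3
p132 = Perm.transpose 1F 2F

-- Permutations are compared by their values: without function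
-- extensionality, propositional equality of the underlying records would
-- be too fine, and the membership proofs must not be counted.

subsetOfSₙ : ∀ {n} → (Permutation′ n → Set) → Setoid 0ℓ 0ℓ
subsetOfSₙ {n} P = record
  { Carrier       = Σ (Permutation′ n) P
  ; _≈_           = λ π σ → proj₁ π ≈ proj₁ σ
  ; isEquivalence = record
    { refl  = λ _ → refl
    ; sym   = λ p i → sym (p i)
    ; trans = λ p q i → trans (p i) (q i)
    }
  }

AvoidersWithDescents : (n k : ℕ) → Setoid 0ℓ 0ℓ
AvoidersWithDescents n k =
  subsetOfSₙ {n} (λ π → Avoids p123 π × Avoids p132 π × des π ≡ k)

HasCardinality : ∀ {a ℓ : Level} → Setoid a ℓ → ℕ → Set (a ⊔ ℓ)
HasCardinality S N = Inverse S (setoid (Fin N))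

-- The lower index may be negative, where truncated subtraction on ℕ
-- would wrongly give n C 0 = 1.

binomial : ℕ → ℤ → ℕ
binomial m (+ j)    = m C j
binomial m -[1+ _ ] = 0

{-# OPTIONS --safe #-}

-- In a permutation avoiding 123 and 132 every entry is the largest or the
-- second largest among itself and the entries to its right. Record this choice
-- as bits b₁ ⋯ bₙ (0 for the largest), so that bₙ = 0, and put b₀ = 0. Position
-- i is an ascent exactly when bᵢ = 1 and bᵢ₊₁ = 0, hence the word b₀ ⋯ bₙ
-- changes its value exactly twice per ascent, and the n - k - 1 ascents
-- correspond to a set of 2(n - k - 1) of the n places where a change may occur.
-- Every set of even size arises, because b₀ = bₙ.

module Submission where

open import Defs
open import Data.Empty using (⊥; ⊥-elim)
open import Data.Fin.Base as Fin
  using (Fin; zero; suc; toℕ; fromℕ; inject₁; punchIn)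
open import Data.Fin.Patterns using (0F; 1F; 2F)
open import Data.Fin.Permutation as Perm
  using (Permutation′; _⟨$⟩ʳ_; _⟨$⟩ˡ_; _≈_; insert; remove; insert-remove)
import Data.Fin.Properties as Fin
open import Data.Integer.Base as ℤ using (+_; _*_; _-_)
import Data.Integer.Properties as ℤ
import Data.Integer.Tactic.RingSolver as ℤ-Solver
open import Data.List.Base using (length; filter; tabulate)
open import Data.List.Properties using (filter-accept; filter-reject)
open import Data.Nat.Base as ℕ using (ℕ; zero; suc; z≤n; s≤s; _≥_; parity)
open import Data.Nat.Combinatorics using (_C_; nCk+nC[k+1]≡[n+1]C[k+1])
import Data.Nat.Properties as ℕ
import Data.Nat.Tactic.RingSolver as ℕ-Solver
open import Data.Parity.Base using (Parity; 0ℙ; 1ℙ; _⁻¹)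
open import Data.Parity.Properties as ℙ using (suc-homo-⁻¹; *-homo-*)
open import Data.Product.Base using (∃-syntax; _×_; _,_; proj₁; proj₂)
open import Data.Sum.Base using (_⊎_; inj₁; inj₂)
open import Data.Sum.Function.Propositional using (_⊎-↔_)
open import Function.Base using (_∘_)
open import Function.Bundles using (Inverse; Injection; Equivalence; _↔_; _⇔_; mk↔ₛ′; mk⇔)
open import Function.Construct.Composition using (inverse; _↔-∘_)
open import Function.Construct.Symmetry using (↔-sym)
open import Function.Properties.Inverse using (↔⇒↣)
open import Function.Related.Propositional using (≡⇒)
open import Relation.Binary.Bundles using (Setoid)
open import Relation.Binary.Definitions using (Tri; tri<; tri≈; tri>)
open import Relation.Binary.PropositionalEquality
open import Relation.Nullary using (¬_; yes; no; contradiction)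
open import Relation.Unary using (Decidable)

private variable
  m n j k : ℕ

-- Subsets of prescribed size

-- The outermost constructor concerns the place between b₀ and b₁; `take` marks a change of the bit
-- there.
data Comb : ℕ → ℕ → Set where
  done : Comb 0 0
  skip : Comb n j → Comb (suc n) j
  take : Comb n j → Comb (suc n) (suc j)

Comb-suc-zero : Comb (suc n) 0 ↔ Comb n 0
Comb-suc-zero = mk↔ₛ′ (λ { (skip w) → w }) skip (λ _ → refl) λ { (skip _) → refl }

Comb-suc-suc : Comb (suc n) (suc j) ↔ (Comb n j ⊎ Comb n (suc j))
Comb-suc-suc = mk↔ₛ′
  (λ { (skip w) → inj₂ w ; (take w) → inj₁ w })
  (λ { (inj₁ w) → take w ; (inj₂ w) → skip w })
  (λ { (inj₁ _) → refl ; (inj₂ _) → refl })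
  (λ { (skip _) → refl ; (take _) → refl })

Comb↔Fin : ∀ n j → Comb n j ↔ Fin (n C j)
Comb↔Fin zero    zero    = mk↔ₛ′ (λ _ → zero) (λ _ → done) (λ { 0F → refl }) λ { done → refl }
Comb↔Fin zero    (suc j) = mk↔ₛ′ (λ ()) (λ ()) (λ ()) (λ ())
Comb↔Fin (suc n) zero    = Comb↔Fin n zero ↔-∘ Comb-suc-zero
Comb↔Fin (suc n) (suc j) =
  ≡⇒ (cong Fin (nCk+nC[k+1]≡[n+1]C[k+1] n j))
    ↔-∘ (↔-sym Fin.+↔⊎
    ↔-∘ ((Comb↔Fin n j ⊎-↔ Comb↔Fin n (suc j))
    ↔-∘ Comb-suc-suc))

-- Pattern avoidance

-- The common content of avoiding 123 and 132: `j` and `k` may come in either order, in position as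
-- well as in value.
NoTwoLarger : Permutation′ n → Set
NoTwoLarger π = ∀ {i j k} → i Fin.< j → i Fin.< k → j ≢ k →
  ¬ (π ⟨$⟩ʳ i Fin.< π ⟨$⟩ʳ j × π ⟨$⟩ʳ i Fin.< π ⟨$⟩ʳ k)

NoTwoLarger-resp-≈ : (π σ : Permutation′ n) → π ≈ σ → NoTwoLarger π → NoTwoLarger σ
NoTwoLarger-resp-≈ π σ π≈σ ok i<j i<k j≢k (σᵢ<σⱼ , σᵢ<σₖ) = ok i<j i<k j≢k
  ( subst₂ Fin._<_ (sym (π≈σ _)) (sym (π≈σ _)) σᵢ<σⱼ
  , subst₂ Fin._<_ (sym (π≈σ _)) (sym (π≈σ _)) σᵢ<σₖ )

⟨$⟩ʳ-injective : (π : Permutation′ n) {i j : Fin n} → π ⟨$⟩ʳ i ≡ π ⟨$⟩ʳ j → i ≡ j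
⟨$⟩ʳ-injective π = Injection.injective (↔⇒↣ π)

-- One implication suffices by trichotomy: if `ρ` does not increase from `a` to `b`, then either `a`
-- equals `b` by injectivity, or `ρ` increases from `b` to `a` and `π` follows it.
monotone⇒Contains : (ρ : Permutation′ m) (π : Permutation′ n) (i : Fin m → Fin n) →
  (∀ a b → a Fin.< b → i a Fin.< i b) →
  (∀ a b → ρ ⟨$⟩ʳ a Fin.< ρ ⟨$⟩ʳ b → π ⟨$⟩ʳ i a Fin.< π ⟨$⟩ʳ i b) →
  Contains ρ π
monotone⇒Contains ρ π i i-mono π-mono = i , i-mono , λ a b → mk⇔ (reflects a b) (π-mono a b)
  where
  reflects : ∀ a b → π ⟨$⟩ʳ i a Fin.< π ⟨$⟩ʳ i b → ρ ⟨$⟩ʳ a Fin.< ρ ⟨$⟩ʳ b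
  reflects a b π< with Fin.<-cmp (ρ ⟨$⟩ʳ a) (ρ ⟨$⟩ʳ b)
  ... | tri< ρ< _ _ = ρ<
  ... | tri≈ _ ρ≡ _ = contradiction π<
    (ℕ.<-irrefl (cong (λ c → toℕ (π ⟨$⟩ʳ i c)) (⟨$⟩ʳ-injective ρ ρ≡)))
  ... | tri> _ _ ρ> = contradiction π< (ℕ.<-asym (π-mono b a ρ>))

triple : Fin n → Fin n → Fin n → Fin 3 → Fin n
triple i j k 0F = i
triple i j k 1F = j
triple i j k 2F = k

triple-mono : {i j k : Fin n} → i Fin.< j → j Fin.< k →
  ∀ a b → a Fin.< b → triple i j k a Fin.< triple i j k b
triple-mono i<j j<k 0F 0F ()
triple-mono i<j j<k 0F 1F _ = i<j
triple-mono i<j j<k 0F 2F _ = ℕ.<-trans i<j j<k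
triple-mono i<j j<k 1F 0F ()
triple-mono i<j j<k 1F 1F (s≤s ())
triple-mono i<j j<k 1F 2F _ = j<k
triple-mono i<j j<k 2F 0F ()
triple-mono i<j j<k 2F 1F (s≤s ())
triple-mono i<j j<k 2F 2F (s≤s (s≤s ()))

Contains-123 : (π : Permutation′ n) {i j k : Fin n} → i Fin.< j → j Fin.< k →
  π ⟨$⟩ʳ i Fin.< π ⟨$⟩ʳ j → π ⟨$⟩ʳ j Fin.< π ⟨$⟩ʳ k → Contains p123 π
Contains-123 π {i} {j} {k} i<j j<k πᵢ<πⱼ πⱼ<πₖ =
  monotone⇒Contains p123 π (triple i j k) (triple-mono i<j j<k) mono
  where
  mono : ∀ a b → p123 ⟨$⟩ʳ a Fin.< p123 ⟨$⟩ʳ b →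
    π ⟨$⟩ʳ triple i j k a Fin.< π ⟨$⟩ʳ triple i j k b
  mono 0F 0F ()
  mono 0F 1F _ = πᵢ<πⱼ
  mono 0F 2F _ = ℕ.<-trans πᵢ<πⱼ πⱼ<πₖ
  mono 1F 0F ()
  mono 1F 1F (s≤s ())
  mono 1F 2F _ = πⱼ<πₖ
  mono 2F 0F ()
  mono 2F 1F (s≤s ())
  mono 2F 2F (s≤s (s≤s ()))

Contains-132 : (π : Permutation′ n) {i j k : Fin n} → i Fin.< j → j Fin.< k →
  π ⟨$⟩ʳ i Fin.< π ⟨$⟩ʳ k → π ⟨$⟩ʳ k Fin.< π ⟨$⟩ʳ j → Contains p132 π
Contains-132 π {i} {j} {k} i<j j<k πᵢ<πₖ πₖ<πⱼ =
  monotone⇒Contains p132 π (triple i j k) (triple-mono i<j j<k) mono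
  where
  mono : ∀ a b → p132 ⟨$⟩ʳ a Fin.< p132 ⟨$⟩ʳ b →
    π ⟨$⟩ʳ triple i j k a Fin.< π ⟨$⟩ʳ triple i j k b
  mono 0F 0F ()
  mono 0F 1F _ = ℕ.<-trans πᵢ<πₖ πₖ<πⱼ
  mono 0F 2F _ = πᵢ<πₖ
  mono 1F 0F ()
  mono 1F 1F (s≤s (s≤s ()))
  mono 1F 2F (s≤s ())
  mono 2F 0F ()
  mono 2F 1F _ = πₖ<πⱼ
  mono 2F 2F (s≤s ())

-- Sort the two later positions; according to the order of their values they complete a 123 or a
-- 132.
Avoids⇒NoTwoLarger : (π : Permutation′ n) → Avoids p123 π → Avoids p132 π → NoTwoLarger π
Avoids⇒NoTwoLarger {n} π avoids-123 avoids-132 {i} {j} {k} i<j i<k j≢k (πᵢ<πⱼ , πᵢ<πₖ) =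
  case-order (Fin.<-cmp j k)
  where
  ordered : ∀ {j k} → i Fin.< j → j Fin.< k →
    π ⟨$⟩ʳ i Fin.< π ⟨$⟩ʳ j → π ⟨$⟩ʳ i Fin.< π ⟨$⟩ʳ k → ⊥
  ordered {j} {k} i<j j<k πᵢ<πⱼ πᵢ<πₖ with Fin.<-cmp (π ⟨$⟩ʳ j) (π ⟨$⟩ʳ k)
  ... | tri< πⱼ<πₖ _ _ = avoids-123 (Contains-123 π i<j j<k πᵢ<πⱼ πⱼ<πₖ)
  ... | tri≈ _ πⱼ≡πₖ _ = ℕ.<-irrefl (cong toℕ (⟨$⟩ʳ-injective π πⱼ≡πₖ)) j<k
  ... | tri> _ _ πₖ<πⱼ = avoids-132 (Contains-132 π i<j j<k πᵢ<πₖ πₖ<πⱼ)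

  case-order : Tri (j Fin.< k) (j ≡ k) (k Fin.< j) → ⊥
  case-order (tri< j<k _ _) = ordered i<j j<k πᵢ<πⱼ πᵢ<πₖ
  case-order (tri≈ _ j≡k _) = j≢k j≡k
  case-order (tri> _ _ k<j) = ordered i<k k<j πᵢ<πₖ πᵢ<πⱼ

-- Both patterns begin with their smallest entry, and an occurrence of any such pattern shows two
-- larger entries to the right.
NoTwoLarger⇒Avoids : (ρ : Permutation′ 3) →
  ρ ⟨$⟩ʳ 0F Fin.< ρ ⟨$⟩ʳ 1F → ρ ⟨$⟩ʳ 0F Fin.< ρ ⟨$⟩ʳ 2F →
  (π : Permutation′ n) → NoTwoLarger π → Avoids ρ π
NoTwoLarger⇒Avoids ρ ρ₀<ρ₁ ρ₀<ρ₂ π ok (i , mono , iso) =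
  ok (mono 0F 1F (s≤s z≤n)) (mono 0F 2F (s≤s z≤n)) (Fin.<⇒≢ (mono 1F 2F (s≤s (s≤s z≤n))))
    (Equivalence.from (iso 0F 1F) ρ₀<ρ₁ , Equivalence.from (iso 0F 2F) ρ₀<ρ₂)

-- Prepending an entry

prepend : Fin (suc n) → Permutation′ n → Permutation′ (suc n)
prepend = insert 0F

punchIn-mono-< : ∀ (i : Fin (suc n)) {j k : Fin n} → j Fin.< k → punchIn i j Fin.< punchIn i k
punchIn-mono-< i j<k = ℕ.≰⇒> (ℕ.<⇒≱ j<k ∘ Fin.punchIn-cancel-≤ i _ _)

punchIn-cancel-< : ∀ (i : Fin (suc n)) {j k : Fin n} → punchIn i j Fin.< punchIn i k → j Fin.< k
punchIn-cancel-< i p<q = ℕ.≰⇒> (ℕ.<⇒≱ p<q ∘ Fin.punchIn-mono-≤ i _ _)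

punchIn-< : ∀ (i : Fin (suc n)) {j : Fin n} → toℕ j ℕ.< toℕ i → punchIn i j Fin.< i
punchIn-< (suc i) {0F}    _         = s≤s z≤n
punchIn-< (suc i) {suc j} (s≤s j<i) = s≤s (punchIn-< i j<i)

punchIn-> : ∀ (i : Fin (suc n)) {j : Fin n} → toℕ i ℕ.≤ toℕ j → i Fin.< punchIn i j
punchIn-> 0F              _         = s≤s z≤n
punchIn-> (suc i) {suc j} (s≤s i≤j) = s≤s (punchIn-> i i≤j)

prepend-cong : {v w : Fin (suc n)} (π σ : Permutation′ n) →
  v ≡ w → π ≈ σ → prepend v π ≈ prepend w σ
prepend-cong π σ v≡w π≈σ 0F      = v≡w
prepend-cong π σ v≡w π≈σ (suc i) = cong₂ punchIn v≡w (π≈σ i)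

prepend-cancel : {v w : Fin (suc n)} (π σ : Permutation′ n) →
  prepend v π ≈ prepend w σ → π ≈ σ
prepend-cancel {v = v} π σ eq i = Fin.punchIn-injective v _ _
  (trans (eq (suc i)) (cong (λ u → punchIn u (σ ⟨$⟩ʳ i)) (sym (eq 0F))))

NoTwoLarger-tail : (v : Fin (suc n)) (σ : Permutation′ n) →
  NoTwoLarger (prepend v σ) → NoTwoLarger σ
NoTwoLarger-tail v σ ok i<j i<k j≢k (σᵢ<σⱼ , σᵢ<σₖ) =
  ok (s≤s i<j) (s≤s i<k) (j≢k ∘ Fin.suc-injective)
    (punchIn-mono-< v σᵢ<σⱼ , punchIn-mono-< v σᵢ<σₖ)

-- The values are 0 to `n` and `v` is at least `n - 1`, so only the value `n` can exceed `v`, and it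
-- occurs once.
NoTwoLarger-prepend : (v : Fin (suc n)) (σ : Permutation′ n) → n ℕ.≤ suc (toℕ v) →
  NoTwoLarger σ → NoTwoLarger (prepend v σ)
NoTwoLarger-prepend {n} v σ n≤1+v ok {0F} {suc j} {suc k} _ _ j≢k (v<πⱼ , v<πₖ) =
  j≢k (⟨$⟩ʳ-injective (prepend v σ) (trans (largest _ v<πⱼ) (sym (largest _ v<πₖ))))
  where
  largest : ∀ x → v Fin.< x → x ≡ fromℕ n
  largest x v<x = Fin.toℕ-injective (trans
    (ℕ.≤-antisym (ℕ.≤-pred (Fin.toℕ<n x)) (ℕ.≤-trans n≤1+v v<x)) (sym (Fin.toℕ-fromℕ n)))
NoTwoLarger-prepend v σ _ ok {suc i} {suc j} {suc k} (s≤s i<j) (s≤s i<k) j≢k (πᵢ<πⱼ , πᵢ<πₖ) =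
  ok i<j i<k (j≢k ∘ cong suc) (punchIn-cancel-< v πᵢ<πⱼ , punchIn-cancel-< v πᵢ<πₖ)

-- Otherwise the two largest values both exceed the first entry, and their positions are distinct
-- and come later.
NoTwoLarger⇒head≥ : (π : Permutation′ (suc n)) → NoTwoLarger π → n ℕ.≤ suc (toℕ (π ⟨$⟩ʳ 0F))
NoTwoLarger⇒head≥ {zero}  π ok = z≤n
NoTwoLarger⇒head≥ {suc m} π ok with suc m ℕ.≤? suc (toℕ (π ⟨$⟩ʳ 0F))
... | yes p = p
... | no ¬p = contradiction
  (larger first v<first , larger second v<second)
  (ok (later first v<first) (later second v<second) distinct)
  where
  first second : Fin (suc (suc m))
  first  = fromℕ (suc m)
  second = inject₁ (fromℕ m)

  v<second : π ⟨$⟩ʳ 0F Fin.< second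
  v<second = subst (toℕ (π ⟨$⟩ʳ 0F) ℕ.<_)
    (sym (trans (Fin.toℕ-inject₁ (fromℕ m)) (Fin.toℕ-fromℕ m))) (ℕ.≤-pred (ℕ.≰⇒> ¬p))

  v<first : π ⟨$⟩ʳ 0F Fin.< first
  v<first = ℕ.<-≤-trans v<second (Fin.≤fromℕ second)

  larger : ∀ x → π ⟨$⟩ʳ 0F Fin.< x → π ⟨$⟩ʳ 0F Fin.< π ⟨$⟩ʳ (π ⟨$⟩ˡ x)
  larger x = subst (π ⟨$⟩ʳ 0F Fin.<_) (sym (Perm.inverseʳ π))

  later : ∀ x → π ⟨$⟩ʳ 0F Fin.< x → 0 ℕ.< toℕ (π ⟨$⟩ˡ x)
  later x v<x with π ⟨$⟩ˡ x in eq
  ... | suc _ = s≤s z≤n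
  ... | 0F    = contradiction
    (subst (λ i → π ⟨$⟩ʳ 0F Fin.< π ⟨$⟩ʳ i) eq (larger x v<x)) (ℕ.<-irrefl refl)

  distinct : π ⟨$⟩ˡ first ≢ π ⟨$⟩ˡ second
  distinct eq = Fin.fromℕ≢inject₁
    (trans (sym (Perm.inverseʳ π)) (trans (cong (π ⟨$⟩ʳ_) eq) (Perm.inverseʳ π)))

-- Descents

-- Allowing different index functions lets the descents of a prepended permutation after its first
-- position be matched with those of its tail.
length-filter-tabulate-cong : ∀ {A B : Set} {P : A → Set} {Q : B → Set}
  (P? : Decidable P) (Q? : Decidable Q) (f : Fin n → A) (g : Fin n → B) →
  (∀ i → P (f i) ⇔ Q (g i)) →
  length (filter P? (tabulate f)) ≡ length (filter Q? (tabulate g))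
length-filter-tabulate-cong {zero}  P? Q? f g P⇔Q = refl
length-filter-tabulate-cong {suc n} P? Q? f g P⇔Q
  with ih ← length-filter-tabulate-cong P? Q? (f ∘ suc) (g ∘ suc) (P⇔Q ∘ suc)
     | P? (f 0F) | Q? (g 0F)
... | yes _ | yes _ = cong suc ih
... | no _  | no _  = ih
... | yes p | no ¬q = contradiction (Equivalence.to (P⇔Q 0F) p) ¬q
... | no ¬p | yes q = contradiction (Equivalence.from (P⇔Q 0F) q) ¬p

des-cong : (π σ : Permutation′ n) → π ≈ σ → des π ≡ des σ
des-cong {zero}  π σ π≈σ = refl
des-cong {suc m} π σ π≈σ = length-filter-tabulate-cong _ _ (λ i → i) (λ i → i) λ i → mk⇔
  (subst₂ Fin._<_ (π≈σ (suc i)) (π≈σ (inject₁ i)))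
  (subst₂ Fin._<_ (sym (π≈σ (suc i))) (sym (π≈σ (inject₁ i))))

module _ (v : Fin (suc (suc m))) (σ : Permutation′ (suc m)) where
  private
    π = prepend v σ

    Descent : Fin (suc m) → Set
    Descent i = π ⟨$⟩ʳ suc i Fin.< π ⟨$⟩ʳ inject₁ i

    descent? : Decidable Descent
    descent? i = (π ⟨$⟩ʳ suc i) Fin.<? (π ⟨$⟩ʳ inject₁ i)

    des-tail : length (filter descent? (tabulate suc)) ≡ des σ
    des-tail = length-filter-tabulate-cong descent? _ suc (λ i → i)
      λ i → mk⇔ (punchIn-cancel-< v) (punchIn-mono-< v)

  -- The second entry of `π` is `punchIn v (σ ⟨$⟩ʳ 0F)`, which is below `v` exactly when `σ ⟨$⟩ʳ 0F`
  -- is; this decides whether the first position is a descent.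
  des-prepend-> : toℕ (σ ⟨$⟩ʳ 0F) ℕ.< toℕ v → des π ≡ suc (des σ)
  des-prepend-> σ₀<v = trans
    (cong length (filter-accept descent? (punchIn-< v σ₀<v))) (cong suc des-tail)

  des-prepend-≤ : toℕ v ℕ.≤ toℕ (σ ⟨$⟩ʳ 0F) → des π ≡ des σ
  des-prepend-≤ v≤σ₀ = trans
    (cong length (filter-reject descent? (ℕ.<-asym (punchIn-> v v≤σ₀)))) des-tail

-- Permutations from the places where the bit changes

-- Bit 0 selects the largest value, bit 1 the second largest. For `m = 0` the value at `1ℙ` is a
-- default, which `decode` never reaches since `Comb 0 j` forces `j = 0`.
candidate : ∀ m → Parity → Fin (suc m)
candidate m       0ℙ = fromℕ m
candidate zero    1ℙ = 0F
candidate (suc m) 1ℙ = inject₁ (fromℕ m)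

toℕ-candidate-1ℙ : ∀ m → toℕ (candidate (suc m) 1ℙ) ≡ m
toℕ-candidate-1ℙ m = trans (Fin.toℕ-inject₁ (fromℕ m)) (Fin.toℕ-fromℕ m)

candidate≥ : ∀ m p → m ℕ.≤ suc (toℕ (candidate m p))
candidate≥ m       0ℙ = ℕ.m≤n⇒m≤1+n (ℕ.≤-reflexive (sym (Fin.toℕ-fromℕ m)))
candidate≥ zero    1ℙ = z≤n
candidate≥ (suc m) 1ℙ = s≤s (ℕ.≤-reflexive (sym (toℕ-candidate-1ℙ m)))

candidate-complete : (v : Fin (suc m)) → m ℕ.≤ suc (toℕ v) → ∃[ p ] v ≡ candidate m p
candidate-complete {zero}  0F _ = 0ℙ , refl
candidate-complete {suc m} v (s≤s m≤v) with toℕ v ℕ.≟ m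
... | yes v≡m = 1ℙ , Fin.toℕ-injective (trans v≡m (sym (toℕ-candidate-1ℙ m)))
... | no  v≢m = 0ℙ , Fin.toℕ-injective (trans
  (ℕ.≤-antisym (ℕ.≤-pred (Fin.toℕ<n v)) (ℕ.≤∧≢⇒< m≤v (v≢m ∘ sym)))
  (sym (Fin.toℕ-fromℕ (suc m))))

candidate-injective : ∀ {p q} → candidate (suc m) p ≡ candidate (suc m) q → p ≡ q
candidate-injective {p = 0ℙ} {0ℙ} _  = refl
candidate-injective {p = 0ℙ} {1ℙ} eq = contradiction eq Fin.fromℕ≢inject₁
candidate-injective {p = 1ℙ} {0ℙ} eq = contradiction (sym eq) Fin.fromℕ≢inject₁
candidate-injective {p = 1ℙ} {1ℙ} _  = refl

-- The word ends with the bit 0, so every bit is the parity of the number of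
-- changes to its right.
decode : Comb n j → Permutation′ n
decode done             = Perm.id
decode (skip {m} {j} w) = prepend (candidate m (parity j)) (decode w)
decode (take {m} {j} w) = prepend (candidate m (parity j)) (decode w)

decode-NoTwoLarger : (w : Comb n j) → NoTwoLarger (decode w)
decode-NoTwoLarger done {()}
decode-NoTwoLarger (skip {m} {j} w) =
  NoTwoLarger-prepend _ (decode w) (candidate≥ m (parity j)) (decode-NoTwoLarger w)
decode-NoTwoLarger (take {m} {j} w) =
  NoTwoLarger-prepend _ (decode w) (candidate≥ m (parity j)) (decode-NoTwoLarger w)

p≢p⁻¹ : ∀ p → p ≢ p ⁻¹
p≢p⁻¹ 0ℙ ()
p≢p⁻¹ 1ℙ ()

-- At equal total size the tails differ in size by one, so the first bits are opposite and the first
-- entries differ.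
skip≉take : (w : Comb n (suc j)) (w′ : Comb n j) → ¬ decode (skip w) ≈ decode (take w′)
skip≉take {suc n} {j} w w′ eq = p≢p⁻¹ (parity (suc j))
  (trans (candidate-injective (eq 0F)) (sym (suc-homo-⁻¹ j)))

decode-injective : (w w′ : Comb n j) → decode w ≈ decode w′ → w ≡ w′
decode-injective done     done      _  = refl
decode-injective (skip w) (skip w′) eq =
  cong skip (decode-injective w w′ (prepend-cancel (decode w) (decode w′) eq))
decode-injective (take w) (take w′) eq =
  cong take (decode-injective w w′ (prepend-cancel (decode w) (decode w′) eq))
decode-injective (skip w) (take w′) eq = contradiction eq (skip≉take w w′)
decode-injective (take w) (skip w′) eq = contradiction (sym ∘ eq) (skip≉take w′ w)

-- The new entry depends on `w` only, so `skip` and `take` give the same permutation, and choosing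
-- between them sets the parity of the size.
extend : (w : Comb n j) → ∀ b → ∃[ j′ ] ∃[ w′ ]
  parity j′ ≡ b × decode {suc n} {j′} w′ ≡ prepend (candidate n (parity j)) (decode w)
extend {j = j} w b with parity j ℙ.≟ b
... | yes eq = j , skip w , eq , refl
... | no neq = suc j , take w , other neq (suc-homo-⁻¹ j) , refl
  where
  other : ∀ {p q r} → p ≢ q → r ⁻¹ ≡ p → r ≡ q
  other {q = 0ℙ} {0ℙ} _ _ = refl
  other {q = 1ℙ} {1ℙ} _ _ = refl
  other {q = 0ℙ} {1ℙ} p≢q refl = contradiction refl p≢q
  other {q = 1ℙ} {0ℙ} p≢q refl = contradiction refl p≢q

-- The parity `b`, which plays the part of b₀, is left free for the induction: the tail is requested
-- with the parity `c` that produces the first entry, and `extend` then provides `b`.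
decode-surjective : (π : Permutation′ (suc m)) → NoTwoLarger π → ∀ b →
  ∃[ j ] ∃[ w ] parity j ≡ b × decode {suc m} {j} w ≈ π
decode-surjective {zero} π ok b with extend done b
... | j , w , eq , _ = j , w , eq , λ i → Fin1-irrelevant _ _
  where
  Fin1-irrelevant : (i j : Fin 1) → i ≡ j
  Fin1-irrelevant 0F 0F = refl
decode-surjective {suc m} π ok b
  with c , head≡ ← candidate-complete (π ⟨$⟩ʳ 0F) (NoTwoLarger⇒head≥ π ok)
  with j , w , refl , w≈ ← decode-surjective (remove 0F π)
    (NoTwoLarger-tail (π ⟨$⟩ʳ 0F) (remove 0F π)
      (NoTwoLarger-resp-≈ π (prepend (π ⟨$⟩ʳ 0F) (remove 0F π))
        (sym ∘ insert-remove 0F π) ok)) c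
  with j′ , w′ , eq , dec ← extend w b =
  j′ , w′ , eq , λ i → trans (cong (_⟨$⟩ʳ i) dec)
    (trans (prepend-cong (decode w) (remove 0F π) (sym head≡) w≈ i) (insert-remove 0F π i))

-- Changes of the bit versus descents

bit : Parity → ℕ
bit 0ℙ = 0
bit 1ℙ = 1

candidate-suc : ∀ m p → toℕ (candidate (suc (suc m)) p) ≡ suc (toℕ (candidate (suc m) p))
candidate-suc m 0ℙ = refl
candidate-suc m 1ℙ = refl

descent-arith : ∀ a d m → a ℕ.+ 2 ℕ.* d ≡ 2 ℕ.* m → a ℕ.+ 2 ℕ.* suc d ≡ 2 ℕ.* suc m
descent-arith a d m eq = trans (lhs a d) (trans (cong (2 ℕ.+_) eq) (sym (ℕ.*-suc 2 m)))
  where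
  lhs : ∀ a d → a ℕ.+ 2 ℕ.* suc d ≡ 2 ℕ.+ (a ℕ.+ 2 ℕ.* d)
  lhs = ℕ-Solver.solve-∀

ascent-arith : ∀ j d m → j ℕ.+ 0 ℕ.+ 2 ℕ.* d ≡ 2 ℕ.* m → suc j ℕ.+ 1 ℕ.+ 2 ℕ.* d ≡ 2 ℕ.* suc m
ascent-arith j d m eq = trans (lhs j d) (trans (cong (2 ℕ.+_) eq) (sym (ℕ.*-suc 2 m)))
  where
  lhs : ∀ j d → suc j ℕ.+ 1 ℕ.+ 2 ℕ.* d ≡ 2 ℕ.+ (j ℕ.+ 0 ℕ.+ 2 ℕ.* d)
  lhs = ℕ-Solver.solve-∀

-- The first bit is parity j, and j + bit (parity j) counts the changes
-- including the one forced by b₀ = 0.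
ChangesPlusTwiceDes : ∀ j → Parity → Permutation′ m → Set
ChangesPlusTwiceDes {m} j p σ =
  j ℕ.+ bit p ℕ.+ 2 ℕ.* des (prepend (candidate m p) σ) ≡ 2 ℕ.* m

-- Equal bits make a descent, because the value selected by a fixed bit grows by one with the
-- length. For an empty `σ` and bit 1 this fails, both values being 0.
repeat-step : ∀ j p (σ : Permutation′ (suc m)) → ChangesPlusTwiceDes j p σ →
  ChangesPlusTwiceDes j p (prepend (candidate (suc m) p) σ)
repeat-step {m} j p σ eq = trans
  (cong (λ d → j ℕ.+ bit p ℕ.+ 2 ℕ.* d)
    (des-prepend-> (candidate (suc (suc m)) p) (prepend (candidate (suc m) p) σ)
      (ℕ.≤-reflexive (sym (candidate-suc m p)))))
  (descent-arith (j ℕ.+ bit p) (des (prepend (candidate (suc m) p) σ)) (suc m) eq)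

-- Bits 0, 1 make a descent, and the rise of `j` is offset by the fall of the forced change. Bits 1,
-- 0 make an ascent, and both terms rise, adding the 2 that a descent would have added.
change-step : ∀ j q {p} (σ : Permutation′ m) → q ⁻¹ ≡ p → ChangesPlusTwiceDes j p σ →
  ChangesPlusTwiceDes (suc j) q (prepend (candidate m p) σ)
change-step {m} j 0ℙ σ refl eq = trans
  (cong (λ d → suc j ℕ.+ 0 ℕ.+ 2 ℕ.* d)
    (des-prepend-> (fromℕ (suc m)) (prepend (candidate m 1ℙ) σ)
      (s≤s (Fin.≤fromℕ (candidate m 1ℙ)))))
  (descent-arith (suc j ℕ.+ 0) d m
    (trans (cong (ℕ._+ 2 ℕ.* d) (sym (ℕ.+-suc j 0))) eq))
  where d = des (prepend (candidate m 1ℙ) σ)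
change-step {m} j 1ℙ σ refl eq = trans
  (cong (λ d → suc j ℕ.+ 1 ℕ.+ 2 ℕ.* d)
    (des-prepend-≤ (candidate (suc m) 1ℙ) (prepend (fromℕ m) σ)
      (ℕ.≤-reflexive (Fin.toℕ-inject₁ (fromℕ m)))))
  (ascent-arith j (des (prepend (fromℕ m) σ)) m eq)

changesPlusTwiceDes : (w : Comb m j) → ChangesPlusTwiceDes j (parity j) (decode w)
changesPlusTwiceDes done                 = refl
-- `repeat-step` needs a nonempty tail; here the two last bits are 0 and the count is computed
-- outright.
changesPlusTwiceDes (skip done)          = refl
changesPlusTwiceDes (skip {suc m} {j} w) =
  repeat-step j (parity j) (decode w) (changesPlusTwiceDes w)
changesPlusTwiceDes (take {m} {j} w)     =
  change-step j (parity (suc j)) (decode w) (suc-homo-⁻¹ j) (changesPlusTwiceDes w)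

-- For even `j` the outermost constructor is `take` exactly when the first bit is 1, so it records
-- precisely the change forced by b₀ = 0.
des-decode : (w : Comb (suc m) j) → parity j ≡ 0ℙ → j ℕ.+ 2 ℕ.* des (decode w) ≡ 2 ℕ.* m
des-decode {m} {j} (skip w) even = begin
  j ℕ.+ 2 ℕ.* d                      ≡⟨ cong (ℕ._+ 2 ℕ.* d) (ℕ.+-identityʳ j) ⟨
  j ℕ.+ bit 0ℙ ℕ.+ 2 ℕ.* d           ≡⟨ cong (λ p → j ℕ.+ bit p ℕ.+ 2 ℕ.* d) even ⟨
  j ℕ.+ bit (parity j) ℕ.+ 2 ℕ.* d   ≡⟨ changesPlusTwiceDes w ⟩
  2 ℕ.* m                            ∎
  where
  open ≡-Reasoning
  d = des (decode (skip w))
des-decode {m} (take {j = j} w) even = begin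
  suc j ℕ.+ 2 ℕ.* d                  ≡⟨ cong (ℕ._+ 2 ℕ.* d) (ℕ.+-comm 1 j) ⟩
  j ℕ.+ bit (0ℙ ⁻¹) ℕ.+ 2 ℕ.* d      ≡⟨ cong (λ p → j ℕ.+ bit (p ⁻¹) ℕ.+ 2 ℕ.* d) even ⟨
  j ℕ.+ bit (parity (suc j) ⁻¹) ℕ.+ 2 ℕ.* d
    ≡⟨ cong (λ p → j ℕ.+ bit p ℕ.+ 2 ℕ.* d) (suc-homo-⁻¹ j) ⟩
  j ℕ.+ bit (parity j) ℕ.+ 2 ℕ.* d   ≡⟨ changesPlusTwiceDes w ⟩
  2 ℕ.* m                            ∎
  where
  open ≡-Reasoning
  d = des (decode (take w))

-- The bijection and the binomial coefficient

encode : (π : Setoid.Carrier (AvoidersWithDescents (suc m) k)) →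
  ∃[ j ] j ℕ.+ 2 ℕ.* k ≡ 2 ℕ.* m × ∃[ w ] decode {suc m} {j} w ≈ proj₁ π
encode (π , avoids-123 , avoids-132 , refl)
  -- Requesting parity `0ℙ` sets b₀ = 0; the number of descents then determines `j`.
  with j , w , even , w≈π ←
    decode-surjective π (Avoids⇒NoTwoLarger π avoids-123 avoids-132) 0ℙ =
  j , trans (cong (λ d → j ℕ.+ 2 ℕ.* d) (sym (des-cong (decode w) π w≈π))) (des-decode w even)
    , w , w≈π

-- Here `d` is the number of ascents, so the size `2 * d` needs no subtraction. Injectivity of
-- `decode` gives the laws for `to`, which is known only as a preimage.
avoiders↔Comb : ∀ k d →
  Inverse (AvoidersWithDescents (suc (k ℕ.+ d)) k) (setoid (Comb (suc (k ℕ.+ d)) (2 ℕ.* d)))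
avoiders↔Comb k d = record
  { to        = to
  ; from      = from
  ; to-cong   = λ {π} {σ} π≈σ → decode-injective (to π) (to σ) λ i →
      trans (to-decodes π i) (trans (π≈σ i) (sym (to-decodes σ i)))
  ; from-cong = λ { refl _ → refl }
  ; inverse   =
      (λ {w} {π} π≈w → decode-injective (to π) w λ i → trans (to-decodes π i) (π≈w i))
    , (λ { {π} refl → to-decodes π })
  }
  where
  Avoiders = Setoid.Carrier (AvoidersWithDescents (suc (k ℕ.+ d)) k)

  codes : (π : Avoiders) → ∃[ w ] decode {_} {2 ℕ.* d} w ≈ proj₁ π
  codes π with j , eq , w ← encode π = subst (λ j → ∃[ w ] decode {_} {j} w ≈ proj₁ π)
    (ℕ.+-cancelʳ-≡ (2 ℕ.* k) j (2 ℕ.* d)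
      (trans eq (trans (ℕ.*-distribˡ-+ 2 k d) (ℕ.+-comm (2 ℕ.* k) (2 ℕ.* d))))) w

  to : Avoiders → Comb _ (2 ℕ.* d)
  to π = proj₁ (codes π)

  to-decodes : ∀ π → decode (to π) ≈ proj₁ π
  to-decodes π = proj₂ (codes π)

  from : Comb _ (2 ℕ.* d) → Avoiders
  from w = decode w
    , NoTwoLarger⇒Avoids p123 (s≤s z≤n) (s≤s z≤n) (decode w) (decode-NoTwoLarger w)
    , NoTwoLarger⇒Avoids p132 (s≤s z≤n) (s≤s z≤n) (decode w) (decode-NoTwoLarger w)
    , ℕ.*-cancelˡ-≡ _ k 2 (ℕ.+-cancelˡ-≡ (2 ℕ.* d) _ _
        -- The parity of `2 * d` is a product with `parity 2`, which computes to `0ℙ`.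
        (trans (des-decode w (*-homo-* 2 d))
          (trans (ℕ.*-distribˡ-+ 2 k d) (ℕ.+-comm (2 ℕ.* k) (2 ℕ.* d)))))

-- The equation from `encode` bounds `2 * k` by `2 * m`.
avoiders-empty : m ℕ.< k → ¬ Setoid.Carrier (AvoidersWithDescents (suc m) k)
avoiders-empty {m} {k} m<k π with j , eq , _ ← encode π =
  ℕ.<⇒≱ (ℕ.*-monoʳ-< 2 m<k) (ℕ.≤-trans (ℕ.m≤n+m (2 ℕ.* k) j) (ℕ.≤-reflexive eq))

lower-index-≤ : ∀ k d → + 2 * (+ suc (k ℕ.+ d) - + k - + 1) ≡ + (2 ℕ.* d)
lower-index-≤ k d = trans (identity (+ k) (+ d)) (sym (ℤ.pos-* 2 d))
  where
  identity : ∀ x y → + 2 * (+ 1 ℤ.+ (x ℤ.+ y) - x - + 1) ≡ + 2 * y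
  identity = ℤ-Solver.solve-∀

-- The right side reduces to a `-[1+_]`, so `binomial` computes to 0 and `Fin` of it is empty.
lower-index-> : ∀ m d →
  + 2 * (+ suc m - + suc (m ℕ.+ d) - + 1) ≡ ℤ.- (+ 2 * + suc d)
lower-index-> m d = identity (+ m) (+ d)
  where
  identity : ∀ x y →
    + 2 * (+ 1 ℤ.+ x - (+ 1 ℤ.+ (x ℤ.+ y)) - + 1) ≡ ℤ.- (+ 2 * (+ 1 ℤ.+ y))
  identity = ℤ-Solver.solve-∀

proposition14 : (n k : ℕ) → n ≥ 1 →
    HasCardinality (AvoidersWithDescents n k)
    (binomial n (+ 2 * (+ n - + k - + 1)))
proposition14 (suc m) k _ with k ℕ.≤? m
... | yes k≤m with d , refl ← ℕ.m≤n⇒∃[o]m+o≡n k≤m =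
  subst (λ z → HasCardinality (AvoidersWithDescents (suc m) k) (binomial (suc m) z))
    (sym (lower-index-≤ k d))
    (inverse (avoiders↔Comb k d) (Comb↔Fin (suc m) (2 ℕ.* d)))
... | no k≰m with d , refl ← ℕ.m≤n⇒∃[o]m+o≡n (ℕ.≰⇒> k≰m) =
  subst (λ z → HasCardinality (AvoidersWithDescents (suc m) k) (binomial (suc m) z))
    (sym (lower-index-> m d)) record
    { to        = ⊥-elim ∘ empty
    ; from      = λ ()
    ; to-cong   = λ {π} _ → ⊥-elim (empty π)
    ; from-cong = λ { {()} }
    ; inverse   = (λ { {()} }) , λ {π} _ → ⊥-elim (empty π)
    }
  where
  empty : ¬ Setoid.Carrier (AvoidersWithDescents (suc m) (suc (m ℕ.+ d)))
  empty = avoiders-empty (s≤s (ℕ.m≤m+n m d))
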